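{- Let $d\ge 1$ and let $\Delta$ be a unit-interval $d$-dimensional simplicial complex such that the deletion of $d$ or fewer vertices (possibly none), however chosen, yields a strongly-connected $d$-dimensional simplicial complex. Then $\Delta$ is Hamiltonian.
   Context: A labeling of a simplicial complex with $n$ vertices is a bijection of its vertex set with $\{1,\dots,n\}$. The deletion of a set of vertices from $\Delta$ is the subcomplex of all faces of $\Delta$ containing none of these vertices. A pure $d$-dimensional simplicial complex is strongly-connected if its dual graph is connected; the dual graph has the facets as nodes, and two facets are joined by an arc iff their intersection has cardinality $d$. Strongly-connected complexes are by convention pure. A pure $d$-dimensional simplicial complex $\Delta$ with $n$ vertices is unit-interval if there is a labeling such that for every $d$-face $F=\{a_0<a_1<\dots<a_d\}$ of $\Delta$, every $(d+1)$-element subset of $\{a_0,a_0+1,\dots,a_d\}$ is a face of $\Delta$. A $d$-dimensional simplicial complex $\Delta$ with $n$ vertices is Hamiltonian if it has a labeling such that for all $i=1,\dots,n$ the set $H_i=\{i,i+1,\dots,i+d\}$, with labels read modulo $n$ (so $n+1$ means $1$, etc.), is a face of $\Delta$. -}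

module Defs where

open import Data.Fin using (Fin; toℕ; _≤_)
open import Data.Fin.Permutation using (Permutation′; _⟨$⟩ʳ_)
open import Data.Fin.Properties using (nonZeroIndex)
open import Data.Fin.Subset using (Subset; ⊥; ⁅_⁆; _∈_; _⊆_; _∩_; ⋃; ∣_∣; Empty)
open import Data.Fin.Subset.Properties using (∉⊥; nonempty?; x∈p∩q⁺; x∈p∩q⁻)
open import Data.List using (map; upTo)
open import Data.Nat using (ℕ; suc; _+_) renaming (_≤_ to _≤ℕ_)
open import Data.Nat.DivMod using (_mod_)
open import Data.Product using (_×_; _,_; proj₁; ∃; ∃-syntax)
open import Data.Vec using (tabulate; lookup)
open import Level using (0ℓ)
open import Relation.Binary.Construct.Closure.ReflexiveTransitive using (Star)
open import Relation.Binary.PropositionalEquality using (_≡_)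
open import Relation.Nullary.Decidable using (_×-dec_; ¬?)
open import Relation.Unary using (Pred; Decidable)

private
  variable
    n : ℕ

-- The vertices are those v : Fin n with ⁅ v ⁆ a face. Not every element of
-- Fin n need be a vertex, so that a deletion lives over the same ground set.
record SimplicialComplex (n : ℕ) : Set₁ where
  field
    IsFace     : Pred (Subset n) 0ℓ
    isFace?    : Decidable IsFace
    ⊥-face     : IsFace ⊥
    downClosed : ∀ {F G} → G ⊆ F → IsFace F → IsFace G

open SimplicialComplex public

-- "Δ has n vertices": its vertex set is the whole of Fin n.
FullVertexSet : SimplicialComplex n → Set
FullVertexSet Δ = ∀ v → IsFace Δ ⁅ v ⁆

deletion : SimplicialComplex n → Subset n → SimplicialComplex n
deletion Δ W = record
  { IsFace     = λ F → IsFace Δ F × Empty (F ∩ W)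
  ; isFace?    = λ F → isFace? Δ F ×-dec ¬? (nonempty? (F ∩ W))
  ; ⊥-face     = ⊥-face Δ , λ { (_ , v∈) → ∉⊥ (proj₁ (x∈p∩q⁻ ⊥ W v∈)) }
  ; downClosed = λ { {F} {G} G⊆F (f , F∩W=∅) →
      downClosed Δ G⊆F f , λ { (v , v∈) →
        let v∈G , v∈W = x∈p∩q⁻ G W v∈
        in F∩W=∅ (v , x∈p∩q⁺ (G⊆F v∈G , v∈W)) } }
  }

IsFacet : SimplicialComplex n → Subset n → Set
IsFacet Δ F = IsFace Δ F × (∀ G → IsFace Δ G → F ⊆ G → G ≡ F)

HasDimension : ℕ → SimplicialComplex n → Set
HasDimension d Δ =
  (∃[ F ] IsFace Δ F × ∣ F ∣ ≡ suc d) × (∀ F → IsFace Δ F → ∣ F ∣ ≤ℕ suc d)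

Pure : ℕ → SimplicialComplex n → Set
Pure d Δ = HasDimension d Δ × (∀ F → IsFacet Δ F → ∣ F ∣ ≡ suc d)

DualEdge : ℕ → SimplicialComplex n → Subset n → Subset n → Set
DualEdge d Δ F G = IsFacet Δ F × IsFacet Δ G × ∣ F ∩ G ∣ ≡ d

StronglyConnected : ℕ → SimplicialComplex n → Set
StronglyConnected d Δ =
  Pure d Δ × (∀ F G → IsFacet Δ F → IsFacet Δ G → Star (DualEdge d Δ) F G)

-- Labels are 0, …, n-1 rather than 1, …, n.
Labeling : ℕ → Set
Labeling = Permutation′

-- The set of vertices whose label lies in S.
withLabels : Labeling n → Subset n → Subset n
withLabels π S = tabulate λ v → lookup S (π ⟨$⟩ʳ v)

IsLabeledFace : SimplicialComplex n → Labeling n → Subset n → Set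
IsLabeledFace Δ π S = IsFace Δ (withLabels π S)

IsMin : Subset n → Fin n → Set
IsMin S a = a ∈ S × (∀ b → b ∈ S → a ≤ b)

IsMax : Subset n → Fin n → Set
IsMax S a = a ∈ S × (∀ b → b ∈ S → b ≤ a)

-- F and G are sets of labels; lo and hi are a₀ and a_d.
IsUnitIntervalLabeling : ℕ → SimplicialComplex n → Labeling n → Set
IsUnitIntervalLabeling d Δ π =
  ∀ F → IsLabeledFace Δ π F → ∣ F ∣ ≡ suc d →
  ∀ lo hi → IsMin F lo → IsMax F hi →
  ∀ G → ∣ G ∣ ≡ suc d → (∀ a → a ∈ G → lo ≤ a × a ≤ hi) →
  IsLabeledFace Δ π G

UnitInterval : ℕ → SimplicialComplex n → Set
UnitInterval d Δ =
  FullVertexSet Δ × Pure d Δ × ∃ (IsUnitIntervalLabeling d Δ)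

-- {i, i+1, …, i+d} modulo n.
cyclicWindow : ℕ → Fin n → Subset n
cyclicWindow {n} d i = ⋃ (map (λ k → ⁅ (toℕ i + k) mod n ⁆) (upTo (suc d)))
  where instance _ = nonZeroIndex i

IsHamiltonianLabeling : ℕ → SimplicialComplex n → Labeling n → Set
IsHamiltonianLabeling d Δ π = ∀ i → IsLabeledFace Δ π (cyclicWindow d i)

Hamiltonian : ℕ → SimplicialComplex n → Set
Hamiltonian d Δ =
  FullVertexSet Δ × HasDimension d Δ × ∃ (IsHamiltonianLabeling d Δ)

{-# OPTIONS --safe #-}
-- Deleting the d labels i+1, …, i+d and following the dual graph from a facet through
-- the last label to a facet through label i, consider the first facet that meets
-- {0, …, i}: its predecessor lies beyond i+d, and they share d vertices, so it
-- reaches at least i+2d. By the unit-interval property, every set of d+1 labels in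
-- {i, …, i+2d} is therefore a face. Reading the labels in the cyclic order
-- 0, 2, 4, …, 5, 3, 1, neighbours differ by at most 2, so that d+1 consecutive
-- labels always lie in such an interval.
module Submission where

open import Defs
open import Algebra.Properties.CommutativeMonoid.Sum using (sum; sum-permute)
open import Data.Empty using (⊥-elim)
open import Data.Fin as Fin using (Fin; zero; suc; toℕ; fromℕ<)
open import Data.Fin.Permutation using (Permutation′; permutation; _⟨$⟩ʳ_; _⟨$⟩ˡ_; flip; inverseˡ; inverseʳ; _∘ₚ_)
open import Data.Fin.Properties using (toℕ<n; toℕ-fromℕ<; toℕ-injective; any?)
open import Data.Fin.Subset using (Subset; Side; inside; outside; _∈_; _∉_; _⊆_; _∪_; _∩_; ⋃; ⁅_⁆; ∁; ⊥; ⊤; ∣_∣; Nonempty)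
open import Data.Fin.Subset.Properties
open import Data.List using ([]; _∷_; map; upTo; length)
open import Data.List.Membership.Propositional using () renaming (_∈_ to _∈ˡ_)
open import Data.List.Membership.Propositional.Properties using (∈-upTo⁺; ∈-upTo⁻)
open import Data.List.Properties using (length-upTo)
open import Data.List.Relation.Unary.Any using (here; there)
open import Data.Nat
open import Data.Nat.DivMod using (_mod_; m%n<n; m<n⇒m%n≡m; m≡m%n+[m/n]*n; [m+kn]%n≡m%n; n%n≡0)
open import Data.Nat.Properties
open import Data.Parity.Base using (Parity; 0ℙ; 1ℙ)
open import Data.Parity.Properties using (+-homo-+; p+p≡0ℙ; suc-homo-⁻¹)
open import Data.Product using (_×_; _,_; proj₁; proj₂; ∃; ∃-syntax; ∃₂)
open import Data.Sum using (_⊎_; inj₁; inj₂; [_,_]′)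
open import Data.Vec using ([]; _∷_; here; there; lookup; tabulate)
open import Data.Vec.Properties using (lookup∘tabulate; tabulate∘lookup; tabulate-cong; []=⇒lookup; lookup⇒[]=)
open import Function using (_∘_)
open import Relation.Binary.Construct.Closure.ReflexiveTransitive using (Star; ε; _◅_)
open import Relation.Binary.PropositionalEquality
open import Relation.Nullary using (¬_; yes; no; contradiction)
open import Relation.Nullary.Decidable using (_×-dec_)
open import Relation.Unary using (Decidable)

private
  variable
    n : ℕ

-- Cardinalities, extreme elements and unions of finite subsets

∣p∪q∣≤∣p∣+∣q∣ : ∀ (p q : Subset n) → ∣ p ∪ q ∣ ≤ ∣ p ∣ + ∣ q ∣
∣p∪q∣≤∣p∣+∣q∣ []            []            = z≤n
∣p∪q∣≤∣p∣+∣q∣ (inside  ∷ p) (t       ∷ q) =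
  s≤s (≤-trans (∣p∪q∣≤∣p∣+∣q∣ p q) (+-monoʳ-≤ ∣ p ∣ (∣p∣≤∣x∷p∣ t q)))
∣p∪q∣≤∣p∣+∣q∣ (outside ∷ p) (inside  ∷ q) =
  ≤-trans (s≤s (∣p∪q∣≤∣p∣+∣q∣ p q)) (≤-reflexive (sym (+-suc ∣ p ∣ ∣ q ∣)))
∣p∪q∣≤∣p∣+∣q∣ (outside ∷ p) (outside ∷ q) = ∣p∪q∣≤∣p∣+∣q∣ p q

subset-between : ∀ {k} (p q : Subset n) → p ⊆ q → ∣ p ∣ ≤ k → k ≤ ∣ q ∣ →
                 ∃[ r ] p ⊆ r × r ⊆ q × ∣ r ∣ ≡ k
subset-between [] [] p⊆q _ z≤n = [] , p⊆q , p⊆q , refl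
subset-between (inside ∷ p) (outside ∷ q) p⊆q _ _ with () ← p⊆q here
subset-between (inside ∷ p) (inside ∷ q) p⊆q (s≤s ∣p∣≤k) (s≤s k≤∣q∣) =
  let r , p⊆r , r⊆q , ∣r∣≡k = subset-between p q (drop-∷-⊆ p⊆q) ∣p∣≤k k≤∣q∣
  in inside ∷ r , s⊆s p⊆r , s⊆s r⊆q , cong suc ∣r∣≡k
subset-between (outside ∷ p) (outside ∷ q) p⊆q ∣p∣≤k k≤∣q∣ =
  let r , p⊆r , r⊆q , ∣r∣≡k = subset-between p q (drop-∷-⊆ p⊆q) ∣p∣≤k k≤∣q∣
  in outside ∷ r , s⊆s p⊆r , s⊆s r⊆q , ∣r∣≡k
subset-between {k = k} (outside ∷ p) (inside ∷ q) p⊆q ∣p∣≤k k≤1+∣q∣ with k ≤? ∣ q ∣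
... | yes k≤∣q∣ =
  let r , p⊆r , r⊆q , ∣r∣≡k = subset-between p q (drop-∷-⊆ p⊆q) ∣p∣≤k k≤∣q∣
  in outside ∷ r , s⊆s p⊆r , out⊆ r⊆q , ∣r∣≡k
-- Now `k` is exactly `suc ∣ q ∣`, so everything has to be taken.
... | no k≰∣q∣ =
  inside ∷ q , p⊆q , ⊆-refl , ≤-antisym (≰⇒> k≰∣q∣) k≤1+∣q∣

minimum : ∀ (S : Subset n) → Nonempty S → ∃ (IsMin S)
minimum (inside  ∷ S) _ = zero , here , λ _ _ → z≤n
minimum (outside ∷ S) (suc x , there x∈S) =
  let a , a∈S , a≤ = minimum S (x , x∈S)
  in suc a , there a∈S , λ { (suc b) (there b∈S) → s≤s (a≤ b b∈S) }

maximum : ∀ (S : Subset n) → Nonempty S → ∃ (IsMax S)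
maximum (s ∷ S) (x , x∈) with nonempty? S
... | yes ne =
  let a , a∈S , ≤a = maximum S ne
  in suc a , there a∈S , λ { zero _ → z≤n ; (suc b) (there b∈S) → s≤s (≤a b b∈S) }
maximum (s ∷ S) (zero  , here)      | no ¬∃ =
  zero , here , λ { zero _ → z≤n ; (suc b) (there b∈S) → contradiction (b , b∈S) ¬∃ }
maximum (s ∷ S) (suc x , there x∈S) | no ¬∃ = contradiction (x , x∈S) ¬∃

module _ {A : Set} (f : A → Fin n) where

  ∈-⋃-⁅⁆⁺ : ∀ {x xs} → x ∈ˡ xs → f x ∈ ⋃ (map (⁅_⁆ ∘ f) xs)
  ∈-⋃-⁅⁆⁺ {x} (here refl)  = p⊆p∪q _ (x∈⁅x⁆ (f x))
  ∈-⋃-⁅⁆⁺ {xs = y ∷ _} (there x∈xs) = q⊆p∪q ⁅ f y ⁆ _ (∈-⋃-⁅⁆⁺ x∈xs)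

  ∈-⋃-⁅⁆⁻ : ∀ {v} xs → v ∈ ⋃ (map (⁅_⁆ ∘ f) xs) → ∃[ x ] x ∈ˡ xs × v ≡ f x
  ∈-⋃-⁅⁆⁻ []       v∈ = ⊥-elim (∉⊥ v∈)
  ∈-⋃-⁅⁆⁻ (x ∷ xs) v∈ with x∈p∪q⁻ ⁅ f x ⁆ _ v∈
  ... | inj₁ v∈⁅fx⁆ = x , here refl , x∈⁅y⁆⇒x≡y (f x) v∈⁅fx⁆
  ... | inj₂ v∈⋃    = let y , y∈xs , v≡fy = ∈-⋃-⁅⁆⁻ xs v∈⋃ in y , there y∈xs , v≡fy

  ∣⋃-⁅⁆∣≤length : ∀ xs → ∣ ⋃ (map (⁅_⁆ ∘ f) xs) ∣ ≤ length xs
  ∣⋃-⁅⁆∣≤length []       = ≤-reflexive (∣⊥∣≡0 n)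
  ∣⋃-⁅⁆∣≤length (x ∷ xs) =
    ≤-trans (∣p∪q∣≤∣p∣+∣q∣ ⁅ f x ⁆ _)
            (+-mono-≤ (≤-reflexive (∣⁅x⁆∣≡1 (f x))) (∣⋃-⁅⁆∣≤length xs))

-- Windows of consecutive residues

module _ .{{_ : NonZero n}} where

  -- Covers both the sets to be deleted and, with `s = toℕ i` and `k = suc d`, the set
  -- `cyclicWindow d i` definitionally.
  window : ℕ → ℕ → Subset n
  window s k = ⋃ (map (λ j → ⁅ (s + j) mod n ⁆) (upTo k))

  -- An inequality because the residues may repeat when `k` exceeds `n`.
  ∣window∣≤ : ∀ s k → ∣ window s k ∣ ≤ k
  ∣window∣≤ s k =
    subst (∣ window s k ∣ ≤_) (length-upTo k) (∣⋃-⁅⁆∣≤length (λ j → (s + j) mod n) (upTo k))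

  toℕ-mod : ∀ x → toℕ (x mod n) ≡ x % n
  toℕ-mod x = toℕ-fromℕ< (m%n<n x n)

  ∈-window⁻ : ∀ {v} s k → v ∈ window s k → ∃[ j ] j < k × toℕ v ≡ (s + j) % n
  ∈-window⁻ s k v∈ =
    let j , j∈ , v≡ = ∈-⋃-⁅⁆⁻ (λ j → (s + j) mod n) (upTo k) v∈
    in j , ∈-upTo⁻ j∈ , trans (cong toℕ v≡) (toℕ-mod (s + j))

  -- Covers the part of a window before it wraps around: there `s + j` equals `toℕ v`, which is its
  -- own residue.
  ∈-window⁺ : ∀ {v} s k → s ≤ toℕ v → toℕ v < s + k → v ∈ window s k
  ∈-window⁺ {v} s k s≤v v<s+k =
    subst (_∈ window s k) (toℕ-injective eq)
      (∈-⋃-⁅⁆⁺ (λ j → (s + j) mod n) (∈-upTo⁺ j<k))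
    where
    j = toℕ v ∸ s
    s+j≡v : s + j ≡ toℕ v
    s+j≡v = m+[n∸m]≡n s≤v
    j<k : j < k
    j<k = +-cancelˡ-< s j k (subst (_< s + k) (sym s+j≡v) v<s+k)
    eq : toℕ ((s + j) mod n) ≡ toℕ v
    eq = trans (toℕ-mod (s + j)) (trans (cong (_% n) s+j≡v) (m<n⇒m%n≡m (toℕ<n v)))

-- Passing between vertices and labels

module _ (π : Labeling n) where

  ∈-withLabels⁺ : ∀ {S v} → π ⟨$⟩ʳ v ∈ S → v ∈ withLabels π S
  ∈-withLabels⁺ {S} {v} πv∈S =
    lookup⇒[]= v _ (trans (lookup∘tabulate _ v) ([]=⇒lookup πv∈S))

  ∈-withLabels⁻ : ∀ {S v} → v ∈ withLabels π S → π ⟨$⟩ʳ v ∈ S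
  ∈-withLabels⁻ {S} {v} v∈ =
    lookup⇒[]= _ S (trans (sym (lookup∘tabulate _ v)) ([]=⇒lookup v∈))

  withLabels-mono : ∀ {S T} → S ⊆ T → withLabels π S ⊆ withLabels π T
  withLabels-mono S⊆T = ∈-withLabels⁺ ∘ S⊆T ∘ ∈-withLabels⁻

  -- `withLabels (flip π) F` is the set of labels occurring in `F`. This lets a face be presented as
  -- a labeled face, as the unit-interval property requires.
  withLabels-flip : ∀ F → withLabels π (withLabels (flip π) F) ≡ F
  withLabels-flip F =
    trans (tabulate-cong λ v → trans (lookup∘tabulate _ (π ⟨$⟩ʳ v)) (cong (lookup F) (inverseˡ π)))
          (tabulate∘lookup F)

-- As a sum of 0/1 indicators, a cardinality is seen to be invariant under relabeling by
-- `sum-permute`.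
∣tabulate∣≡∑ : ∀ (f : Fin n → Side) → ∣ tabulate f ∣ ≡ sum +-0-commutativeMonoid (λ v → ∣ f v ∷ [] ∣)
∣tabulate∣≡∑ {zero}  f = refl
∣tabulate∣≡∑ {suc n} f with f zero
... | inside  = cong suc (∣tabulate∣≡∑ (f ∘ suc))
... | outside = ∣tabulate∣≡∑ (f ∘ suc)

∣withLabels∣ : ∀ (π : Labeling n) S → ∣ withLabels π S ∣ ≡ ∣ S ∣
∣withLabels∣ π S = begin
  ∣ withLabels π S ∣                                  ≡⟨ ∣tabulate∣≡∑ (λ v → lookup S (π ⟨$⟩ʳ v)) ⟩
  sum +-0-commutativeMonoid (indicator ∘ (π ⟨$⟩ʳ_))   ≡⟨ sum-permute +-0-commutativeMonoid indicator π ⟨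
  sum +-0-commutativeMonoid indicator                 ≡⟨ ∣tabulate∣≡∑ (lookup S) ⟨
  ∣ tabulate (lookup S) ∣                             ≡⟨ cong ∣_∣ (tabulate∘lookup S) ⟩
  ∣ S ∣                                               ∎
  where
  open ≡-Reasoning
  indicator = λ v → ∣ lookup S v ∷ [] ∣

-- Extending faces to facets

module _ (Δ : SimplicialComplex n) where

  private
    -- The fuel `k` bounds the number of proper enlargements: each one raises the cardinality, which
    -- cannot exceed `n`.
    extend : ∀ k F → n < k + ∣ F ∣ → IsFace Δ F → ∃[ G ] IsFacet Δ G × F ⊆ G
    extend zero    F n<∣F∣ _ = contradiction (∣p∣≤n F) (<⇒≱ n<∣F∣)
    extend (suc k) F n<    f with anySubset? (λ G → isFace? Δ G ×-dec F ⊂? G)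
    ... | yes (G , g , F⊂G) =
      let H , facet , G⊆H = extend k G (<-≤-trans n< (subst (_≤ k + ∣ G ∣) (+-suc k ∣ F ∣) (+-monoʳ-≤ k (p⊂q⇒∣p∣<∣q∣ F⊂G)))) g
      in H , facet , G⊆H ∘ proj₁ F⊂G
    ... | no ¬∃ = F , (f , maximal) , ⊆-refl
      where
      G⊆F : ∀ G → IsFace Δ G → F ⊆ G → G ⊆ F
      G⊆F G g F⊆G {x} x∈G with x ∈? F
      ... | yes x∈F = x∈F
      ... | no  x∉F = contradiction (G , g , (λ {y} → F⊆G {y}) , x , x∈G , x∉F) ¬∃
      maximal : ∀ G → IsFace Δ G → F ⊆ G → G ≡ F
      maximal G g F⊆G = ⊆-antisym (G⊆F G g F⊆G) F⊆G

  facet-above : ∀ F → IsFace Δ F → ∃[ G ] IsFacet Δ G × F ⊆ G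
  facet-above F = extend (suc n) F (m≤m+n (suc n) ∣ F ∣)

-- The zigzag order and its inverse

-- This is |a - b| ≤ k, split into two inequalities because subtraction truncates.
Within : ℕ → ℕ → ℕ → Set
Within k a b = a ≤ k + b × b ≤ k + a

within-sym : ∀ {k a b} → Within k a b → Within k b a
within-sym (p , q) = q , p

within-mono : ∀ {k l a b} → k ≤ l → Within k a b → Within l a b
within-mono k≤l (p , q) = ≤-trans p (+-monoˡ-≤ _ k≤l) , ≤-trans q (+-monoˡ-≤ _ k≤l)

within-trans : ∀ {k l a b c} → Within k a b → Within l b c → Within (k + l) a c
within-trans {k} {l} {a} {b} {c} (a≤ , b≤) (b≤′ , c≤) =
  ≤-trans a≤ (≤-trans (+-monoʳ-≤ k b≤′) (≤-reflexive (sym (+-assoc k l c)))) ,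
  ≤-trans c≤ (≤-trans (+-monoʳ-≤ l b≤)
    (≤-reflexive (trans (sym (+-assoc l k a)) (cong (_+ a) (+-comm l k)))))

-- On {0, …, m} this runs through 0, 2, 4, … upwards and then …, 5, 3, 1 downwards.
zigzag : ℕ → ℕ → ℕ
zigzag m p = (p + p) ⊓ suc ((m ∸ p) + (m ∸ p))

zigzag≤ : ∀ m p → p ≤ m → zigzag m p ≤ m
zigzag≤ m p p≤m with p + p ≤? m
... | yes 2p≤m = ≤-trans (m⊓n≤m _ _) 2p≤m
-- Here `q < p`, so 2q < q + p = m; `lemma` is this inequality with `p` added on both sides.
... | no  2p≰m = ≤-trans (m⊓n≤n (p + p) _) (+-cancelʳ-< p _ m lemma)
  where
  open ≤-Reasoning
  q = m ∸ p
  q+p≡m : q + p ≡ m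
  q+p≡m = m∸n+n≡m p≤m
  q<p : q < p
  q<p = +-cancelʳ-< p q p (subst (_< p + p) (sym q+p≡m) (≰⇒> 2p≰m))
  lemma : q + q + p < m + p
  lemma = begin-strict
    q + q + p    ≡⟨ +-assoc q q p ⟩
    q + (q + p)  ≡⟨ cong (q +_) q+p≡m ⟩
    q + m        <⟨ +-monoˡ-< m q<p ⟩
    p + m        ≡⟨ +-comm p m ⟩
    m + p        ∎

half : ∀ ℓ → ∃[ j ] (ℓ ≡ j + j ⊎ ℓ ≡ suc (j + j))
half zero = 0 , inj₁ refl
half (suc ℓ) with half ℓ
... | j , inj₁ eq = j , inj₂ (cong suc eq)
... | j , inj₂ eq = suc j , inj₁ (cong suc (trans eq (sym (+-suc j j))))

reflect : Parity → ℕ → ℕ → ℕ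
reflect 0ℙ m j = j
reflect 1ℙ m j = m ∸ j

-- The inverse of `zigzag m`: the even label 2j sits at place j of the ascent, the odd label 2j + 1
-- at place m - j of the descent.
position : ℕ → ℕ → ℕ
position m ℓ = reflect (parity ℓ) m ⌊ ℓ /2⌋

position≤ : ∀ m ℓ → ℓ ≤ m → position m ℓ ≤ m
position≤ m ℓ ℓ≤m with parity ℓ
... | 0ℙ = ≤-trans (⌊n/2⌋≤n ℓ) ℓ≤m
... | 1ℙ = m∸n≤m m ⌊ ℓ /2⌋

parity-double : ∀ j → parity (j + j) ≡ 0ℙ
parity-double j = trans (+-homo-+ j j) (p+p≡0ℙ (parity j))

parity-1+double : ∀ j → parity (suc (j + j)) ≡ 1ℙ
parity-1+double j with parity (suc (j + j)) | trans (suc-homo-⁻¹ (j + j)) (parity-double j)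
... | 1ℙ | _ = refl

position-even : ∀ m j → position m (j + j) ≡ j
position-even m j rewrite parity-double j = sym (n≡⌊n+n/2⌋ j)

position-odd : ∀ m j → position m (suc (j + j)) ≡ m ∸ j
position-odd m j rewrite parity-1+double j = cong (m ∸_) (sym (n≡⌈n+n/2⌉ j))

-- Parity reveals which of the two terms was the minimum, and each determines `p`.
position-zigzag : ∀ m p → p ≤ m → position m (zigzag m p) ≡ p
position-zigzag m p p≤m with ≤-total (p + p) (suc ((m ∸ p) + (m ∸ p)))
... | inj₁ ≤ = trans (cong (position m) (m≤n⇒m⊓n≡m ≤)) (position-even m p)
... | inj₂ ≥ = trans (cong (position m) (m≥n⇒m⊓n≡n ≥))
                     (trans (position-odd m (m ∸ p)) (m∸[m∸n]≡n p≤m))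

-- The bound `ℓ ≤ m` gives j ≤ m - j for even and j < m - j for odd labels, so the minimum is the
-- term of the right parity.
zigzag-position : ∀ m ℓ → ℓ ≤ m → zigzag m (position m ℓ) ≡ ℓ
zigzag-position m ℓ ℓ≤m with half ℓ
... | j , inj₁ refl = trans (cong (zigzag m) (position-even m j))
  (m≤n⇒m⊓n≡m (m≤n⇒m≤1+n (+-mono-≤ j≤m∸j j≤m∸j)))
  where
  j≤m∸j : j ≤ m ∸ j
  j≤m∸j = m+n≤o⇒m≤o∸n j ℓ≤m
... | j , inj₂ refl = trans (cong (zigzag m) (position-odd m j))
  (trans (cong (λ k → (m ∸ j + (m ∸ j)) ⊓ suc (k + k)) (m∸[m∸n]≡n j≤m))
         (m≥n⇒m⊓n≡n (+-mono-≤ j<m∸j (<⇒≤ j<m∸j))))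
  where
  j<m∸j : j < m ∸ j
  j<m∸j = m+n≤o⇒m≤o∸n (suc j) ℓ≤m
  j≤m : j ≤ m
  j≤m = ≤-trans (m≤n+m j (suc j)) ℓ≤m

-- One of the two terms rises by 2 and the other falls by 2, so their minimum moves by at most 2.
zigzag-step : ∀ m p → p < m → Within 2 (zigzag m p) (zigzag m (suc p))
zigzag-step m p p<m =
  ⊓-mono-≤ (≤-trans (m≤n+m (p + p) 4) (≤-reflexive (cong (3 +_) (sym (+-suc p p)))))
           (≤-reflexive (cong suc 2q≡)) ,
  ⊓-mono-≤ (≤-reflexive (cong suc (+-suc p p)))
           (≤-trans (s≤s (≤-trans (m≤n+m (r + r) 2) (≤-reflexive (sym 2q≡)))) (m≤n+m _ 2))
  where
  q = m ∸ p
  r = m ∸ suc p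
  q≡1+r : q ≡ suc r
  q≡1+r = +-∸-assoc 1 p<m
  2q≡ : q + q ≡ 2 + (r + r)
  2q≡ = trans (cong (λ k → k + k) q≡1+r) (cong suc (+-suc r r))

-- Reading the zigzag cyclically

module _ (m : ℕ) where

  private
    1+m = suc m

    σ : ℕ → ℕ
    σ x = zigzag m (x % 1+m)

  suc-% : ∀ x → suc x % 1+m ≡ suc (x % 1+m) % 1+m
  suc-% x = trans (cong (λ y → suc y % 1+m) (m≡m%n+[m/n]*n x 1+m))
                  ([m+kn]%n≡m%n (suc (x % 1+m)) (x / 1+m) 1+m)

  cyclic-step : ∀ x → Within 2 (σ x) (σ (suc x))
  cyclic-step x with x % 1+m <? m
  ... | yes x%n<m = subst (λ y → Within 2 (σ x) (zigzag m y))
                          (sym (trans (suc-% x) (m<n⇒m%n≡m (s≤s x%n<m))))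
                          (zigzag-step m (x % 1+m) x%n<m)
  -- The wrap from place `m` back to place 0: the labels there are at most 1 and 0.
  ... | no x%n≮m = subst₂ (λ y z → Within 2 (zigzag m y) (zigzag m z)) (sym x%n≡m) (sym 1+x%n≡0)
    ( ≤-trans (m⊓n≤n (m + m) _) (≤-trans (≤-reflexive (cong (λ k → suc (k + k)) (n∸n≡0 m))) (s≤s z≤n))
    , z≤n)
    where
    x%n≡m : x % 1+m ≡ m
    x%n≡m = ≤-antisym (≤-pred (m%n<n x 1+m)) (≮⇒≥ x%n≮m)
    1+x%n≡0 : suc x % 1+m ≡ 0
    1+x%n≡0 = trans (suc-% x) (trans (cong (λ y → suc y % 1+m) x%n≡m) (n%n≡0 1+m))

  cyclic-steps : ∀ k x → Within (k + k) (σ x) (σ (x + k))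
  cyclic-steps zero    x rewrite +-identityʳ x = ≤-refl , ≤-refl
  cyclic-steps (suc k) x rewrite +-suc x k | +-suc k k =
    within-trans (cyclic-step x) (cyclic-steps k (suc x))

  -- Two places of a window are at most `d` steps apart and each step costs at most 2. Since `σ`
  -- reduces modulo `1+m`, windows that wrap need no separate case.
  cyclic-window : ∀ d s {j k} → j ≤ d → k ≤ d → Within (d + d) (σ (s + j)) (σ (s + k))
  cyclic-window d s {j} {k} j≤d k≤d =
    [ (λ j≤k → ordered j≤k k≤d) , (λ k≤j → within-sym (ordered k≤j j≤d)) ]′ (≤-total j k)
    where
    ordered : ∀ {j k} → j ≤ k → k ≤ d → Within (d + d) (σ (s + j)) (σ (s + k))
    ordered {j} {k} j≤k k≤d =
      within-mono (+-mono-≤ k∸j≤d k∸j≤d)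
        (subst (λ y → Within (k ∸ j + (k ∸ j)) (σ (s + j)) (σ y))
               (trans (+-assoc s j (k ∸ j)) (cong (s +_) (m+[n∸m]≡n j≤k)))
               (cyclic-steps (k ∸ j) (s + j)))
      where
      k∸j≤d : k ∸ j ≤ d
      k∸j≤d = ≤-trans (m∸n≤m k j) k≤d

  private
    restrict : (f : ℕ → ℕ) → (∀ x → x ≤ m → f x ≤ m) → Fin 1+m → Fin 1+m
    restrict f f≤ i = fromℕ< (s≤s (f≤ (toℕ i) (≤-pred (toℕ<n i))))

    inverse : ∀ f g f≤ g≤ → (∀ x → x ≤ m → f (g x) ≡ x) →
              ∀ i → restrict f f≤ (restrict g g≤ i) ≡ i
    inverse f g f≤ g≤ fg≡id i = toℕ-injective
      (trans (toℕ-fromℕ< _) (trans (cong f (toℕ-fromℕ< _)) (fg≡id (toℕ i) (≤-pred (toℕ<n i)))))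

  -- Directed from labels to places, so that composing it after a labeling makes the places the new
  -- labels.
  zigzagPositions : Permutation′ 1+m
  zigzagPositions = permutation
    (restrict (position m) (position≤ m)) (restrict (zigzag m) (zigzag≤ m))
    (inverse _ _ (position≤ m) (zigzag≤ m) (position-zigzag m))
    (inverse _ _ (zigzag≤ m) (position≤ m) (zigzag-position m))

  toℕ-zigzagPositions : ∀ ℓ → toℕ (zigzagPositions ⟨$⟩ʳ ℓ) ≡ position m (toℕ ℓ)
  toℕ-zigzagPositions ℓ = toℕ-fromℕ< _

-- Faces spanning long intervals, from paths in deletions

-- Decidability lets the walk test each node and stop at the first one in `P`.
Star-crossing : ∀ {A : Set} {E : A → A → Set} {P : A → Set} → Decidable P →
                ∀ {x y} → Star E x y → ¬ P x → P y → ∃₂ λ u v → E u v × ¬ P u × P v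
Star-crossing P? ε ¬Px Py = contradiction Py ¬Px
Star-crossing P? (_◅_ {j = z} e es) ¬Px Py with P? z
... | yes Pz = _ , _ , e , ¬Px , Pz
... | no ¬Pz = Star-crossing P? es ¬Pz Py

module _ {m d : ℕ} (1≤d : 1 ≤ d) (Δ : SimplicialComplex (suc m))
         (sc : ∀ (W : Subset (suc m)) → ∣ W ∣ ≤ d → StronglyConnected d (deletion Δ W)) where

  private
    1+m = suc m

    pureΔ : ∀ W → ∣ W ∣ ≤ d → Pure d (deletion Δ W)
    pureΔ W ∣W∣≤d = proj₁ (sc W ∣W∣≤d)

  -- Delete a set of exactly `d` vertices: some face with `suc d` vertices survives, disjoint from
  -- that set.
  2d<n : d ≤ 1+m → d + d < 1+m
  2d<n d≤n with subset-between {k = d} ⊥ ⊤ (λ x∈⊥ → contradiction x∈⊥ ∉⊥)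
                  (≤-trans (≤-reflexive (∣⊥∣≡0 1+m)) z≤n) (subst (d ≤_) (sym (∣⊤∣≡n 1+m)) d≤n)
  ... | W , _ , _ , ∣W∣≡d with pureΔ W (≤-reflexive ∣W∣≡d)
  ... | ((F , (_ , F∩W=∅) , ∣F∣≡1+d) , _) , _ = m≤o∸n⇒m+n≤o (suc d) d≤n (begin
    suc d      ≡⟨ ∣F∣≡1+d ⟨
    ∣ F ∣      ≤⟨ p⊆q⇒∣p∣≤∣q∣ (λ {v} v∈F → x∉p⇒x∈∁p λ v∈W → F∩W=∅ (v , x∈p∩q⁺ (v∈F , v∈W))) ⟩
    ∣ ∁ W ∣    ≡⟨ ∣∁p∣≡n∸∣p∣ W ⟩
    1+m ∸ ∣ W ∣  ≡⟨ cong (1+m ∸_) ∣W∣≡d ⟩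
    1+m ∸ d      ∎)
    where open ≤-Reasoning

  module _ (vertices : FullVertexSet Δ) (π : Labeling 1+m) where

    label : Fin 1+m → ℕ
    label v = toℕ (π ⟨$⟩ʳ v)

    -- The extreme labels of such a face enclose all labels from `a` to `b`, which is what the
    -- unit-interval property needs.
    Spanning : ℕ → ℕ → Subset 1+m → Set
    Spanning a b F = IsFace Δ F × ∣ F ∣ ≡ suc d ×
                     (∃[ v ] v ∈ F × label v ≤ a) × (∃[ v ] v ∈ F × b ≤ label v)

    module _ (i : ℕ) (i+2d<n : i + (d + d) < 1+m) where

      private
        W : Subset 1+m
        W = withLabels π (window (suc i) d)

        ∣W∣≤d : ∣ W ∣ ≤ d
        ∣W∣≤d = ≤-trans (≤-reflexive (∣withLabels∣ π (window (suc i) d))) (∣window∣≤ (suc i) d)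

        i+d<n : i + d < 1+m
        i+d<n = ≤-<-trans (+-monoʳ-≤ i (m≤m+n d d)) i+2d<n

        -- The deleted window does not wrap, because `i + d` is still a label.
        W-bounds : ∀ (x : Fin 1+m) → x ∈ window (suc i) d → i < toℕ x × toℕ x ≤ i + d
        W-bounds x x∈ with ∈-window⁻ (suc i) d x∈
        ... | j , j<d , x≡ =
          subst (λ y → i < y × y ≤ i + d) (sym (trans x≡ (m<n⇒m%n≡m (≤-<-trans ≤i+d i+d<n))))
                (s≤s (m≤m+n i j) , ≤i+d)
          where
          ≤i+d : suc i + j ≤ i + d
          ≤i+d = subst (_≤ i + d) (+-suc i j) (+-monoʳ-≤ i j<d)

        facet-with-label : ∀ x → x ∉ window (suc i) d →
                           ∃[ F ] IsFacet (deletion Δ W) F × π ⟨$⟩ˡ x ∈ F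
        facet-with-label x x∉ =
          let F , facet , v⊆F = facet-above (deletion Δ W) ⁅ v ⁆ (vertices v , disjoint)
          in F , facet , v⊆F (x∈⁅x⁆ v)
          where
          v = π ⟨$⟩ˡ x
          disjoint : ¬ Nonempty (⁅ v ⁆ ∩ W)
          disjoint (u , u∈) =
            let u∈⁅v⁆ , u∈W = x∈p∩q⁻ ⁅ v ⁆ W u∈
            in x∉ (subst (_∈ window (suc i) d)
                     (trans (cong (π ⟨$⟩ʳ_) (x∈⁅y⁆⇒x≡y v u∈⁅v⁆)) (inverseʳ π)) (∈-withLabels⁻ π u∈W))

        Low : Subset 1+m → Set
        Low X = ∃[ v ] v ∈ X × label v ≤ i

        low? : Decidable Low
        low? X = any? λ v → v ∈? X ×-dec label v ≤? i

        -- For k = d: above the deleted window and below i + 2d there are only d - 1 labels.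
        2d-split : ∀ {k} → 1 ≤ k → i + (k + k) ≡ suc i + k + (k ∸ 1)
        2d-split {suc e} _ = trans (cong (i +_) (cong suc (+-comm e (suc e))))
          (trans (+-suc i (suc e + e)) (cong suc (sym (+-assoc i (suc e) e))))

        -- A pigeonhole argument: if `Y` had no label from i + 2d on, its `d` common vertices with
        -- `X` would have to fit into the d - 1 labels strictly between i + d and i + 2d.
        spanning-edge : ∀ {X Y} → DualEdge d (deletion Δ W) X Y → ¬ Low X → Low Y →
                        Spanning i (i + (d + d)) Y
        spanning-edge {X} {Y} ((x , _) , facetY , ∣X∩Y∣≡d) ¬lowX lowY
          with any? (λ v → v ∈? Y ×-dec i + (d + d) ≤? label v)
        ... | yes high = proj₁ (proj₁ facetY) , proj₂ (pureΔ W ∣W∣≤d) Y facetY , lowY , high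
        ... | no ¬high = contradiction d≤d∸1 (<⇒≱ (d∸1<d 1≤d))
          where
          d∸1<d : ∀ {k} → 1 ≤ k → k ∸ 1 < k
          d∸1<d (s≤s _) = ≤-refl

          X∩Y⊆ : X ∩ Y ⊆ withLabels π (window (suc i + d) (d ∸ 1))
          X∩Y⊆ {v} v∈ = ∈-withLabels⁺ π (∈-window⁺ (suc i + d) (d ∸ 1) lower upper)
            where
            v∈X = proj₁ (x∈p∩q⁻ X Y v∈)
            v∈Y = proj₂ (x∈p∩q⁻ X Y v∈)
            lower : suc i + d ≤ label v
            -- A smaller label would either be at most `i`, making `X` low, or lie in the deleted
            -- window, which `X` avoids.
            lower = ≮⇒≥ λ v<i+d → proj₂ x (v , x∈p∩q⁺
              (v∈X , ∈-withLabels⁺ π (∈-window⁺ (suc i) d (≰⇒> λ v≤i → ¬lowX (v , v∈X , v≤i)) v<i+d)))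
            upper : label v < suc i + d + (d ∸ 1)
            upper = subst (label v <_) (2d-split 1≤d) (≰⇒> λ high → ¬high (v , v∈Y , high))

          open ≤-Reasoning
          d≤d∸1 : d ≤ d ∸ 1
          d≤d∸1 = begin
            d                                              ≡⟨ ∣X∩Y∣≡d ⟨
            ∣ X ∩ Y ∣                                      ≤⟨ p⊆q⇒∣p∣≤∣q∣ X∩Y⊆ ⟩
            ∣ withLabels π (window (suc i + d) (d ∸ 1)) ∣  ≡⟨ ∣withLabels∣ π (window (suc i + d) (d ∸ 1)) ⟩
            ∣ window {1+m} (suc i + d) (d ∸ 1) ∣             ≤⟨ ∣window∣≤ (suc i + d) (d ∸ 1) ⟩
            d ∸ 1                                          ∎

        i<n : i < 1+m
        i<n = ≤-<-trans (m≤m+n i d) i+d<n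

        first last : Fin 1+m
        first = fromℕ< i<n
        last  = fromℕ< (n<1+n m)

        first∉ : first ∉ window (suc i) d
        first∉ first∈ = <-irrefl (sym (toℕ-fromℕ< i<n)) (proj₁ (W-bounds first first∈))

        last∉ : last ∉ window (suc i) d
        -- From `1 ≤ d` follows i + d < i + 2d ≤ m, so the last label is beyond the window.
        last∉ last∈ = <⇒≱ (<-≤-trans (+-monoʳ-< i (m<m+n d 1≤d)) (≤-pred i+2d<n))
                      (subst (_≤ i + d) (toℕ-fromℕ< (n<1+n m)) (proj₂ (W-bounds last last∈)))

        label-π⁻¹-fromℕ< : ∀ {x} (x<n : x < 1+m) → label (π ⟨$⟩ˡ fromℕ< x<n) ≡ x
        label-π⁻¹-fromℕ< x<n = trans (cong toℕ (inverseʳ π)) (toℕ-fromℕ< x<n)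

      spanning-face : ∃ (Spanning i (i + (d + d)))
      spanning-face with facet-with-label first first∉ | facet-with-label last last∉
      ... | F , facetF , first∈F | G , facetG , last∈G with low? G
      ... | yes lowG = G , proj₁ (proj₁ facetG) , proj₂ (pureΔ W ∣W∣≤d) G facetG , lowG ,
        (_ , last∈G , ≤-trans (≤-pred i+2d<n) (≤-reflexive (sym (label-π⁻¹-fromℕ< (n<1+n m)))))
      ... | no ¬lowG =
        let lowF = _ , first∈F , ≤-reflexive (label-π⁻¹-fromℕ< i<n)
            path = proj₂ (sc W ∣W∣≤d) G F facetG facetF
            X , Y , edge , ¬lowX , lowY = Star-crossing low? path ¬lowG lowF
        in Y , spanning-edge edge ¬lowX lowY

    -- From spanning faces to the Hamiltonian labeling

    -- The unit-interval property speaks of sets with exactly `suc d` labels, so `S` is first padded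
    -- with labels of a spanning face. These stay between its extremes, and `S` is a face by
    -- downward closure.
    interval-face : IsUnitIntervalLabeling d Δ π → ∀ i → i + (d + d) < 1+m →
                    ∀ S → ∣ S ∣ ≤ suc d → (∀ a → a ∈ S → i ≤ toℕ a × toℕ a ≤ i + (d + d)) →
                    IsLabeledFace Δ π S
    interval-face unitInterval i i+2d<n S ∣S∣≤1+d S⊆
      with F , f , ∣F∣≡1+d , (u , u∈F , u≤i) , (v , v∈F , i+2d≤v) ← spanning-face i i+2d<n =
      let G , S⊆G , G⊆ , ∣G∣≡1+d = subset-between S (S ∪ F′) (p⊆p∪q F′) ∣S∣≤1+d
            (≤-trans (≤-reflexive (sym ∣F′∣≡1+d)) (∣q∣≤∣p∪q∣ S F′))
      in downClosed Δ (withLabels-mono π S⊆G)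
           (unitInterval F′ (subst (IsFace Δ) (sym (withLabels-flip π F)) f) ∣F′∣≡1+d
              lo hi isMin isMax G ∣G∣≡1+d (λ a → bounds a ∘ G⊆))
      where
      F′ : Subset 1+m
      F′ = withLabels (flip π) F

      label∈ : ∀ {v} → v ∈ F → π ⟨$⟩ʳ v ∈ F′
      label∈ v∈F = ∈-withLabels⁺ (flip π) (subst (_∈ F) (sym (inverseˡ π)) v∈F)

      lo = proj₁ (minimum F′ (_ , label∈ u∈F))
      hi = proj₁ (maximum F′ (_ , label∈ u∈F))

      isMin : IsMin F′ lo
      isMin = proj₂ (minimum F′ (_ , label∈ u∈F))

      isMax : IsMax F′ hi
      isMax = proj₂ (maximum F′ (_ , label∈ u∈F))

      ∣F′∣≡1+d : ∣ F′ ∣ ≡ suc d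
      ∣F′∣≡1+d = trans (∣withLabels∣ (flip π) F) ∣F∣≡1+d

      lo≤i : toℕ lo ≤ i
      lo≤i = ≤-trans (proj₂ isMin _ (label∈ u∈F)) u≤i
      i+2d≤hi : i + (d + d) ≤ toℕ hi
      i+2d≤hi = ≤-trans i+2d≤v (proj₂ isMax _ (label∈ v∈F))

      bounds : ∀ a → a ∈ S ∪ F′ → lo Fin.≤ a × a Fin.≤ hi
      bounds a a∈ with x∈p∪q⁻ S F′ a∈
      ... | inj₁ a∈S  = let i≤a , a≤ = S⊆ a a∈S in ≤-trans lo≤i i≤a , ≤-trans a≤ i+2d≤hi
      ... | inj₂ a∈F′ = proj₂ isMin a a∈F′ , proj₂ isMax a a∈F′

    -- The set `S` collects the labels under `π` found at the places of one cyclic window. They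
    -- spread over at most 2d, so it remains to fit an interval of that length around them.
    zigzag-hamiltonian : IsUnitIntervalLabeling d Δ π → d + d < 1+m →
                         IsHamiltonianLabeling d Δ (π ∘ₚ zigzagPositions m)
    zigzag-hamiltonian unitInterval 2d<n i = subst (IsFace Δ) withLabels-∘ₚ face
      where
      τ = zigzagPositions m
      S : Subset 1+m
      S = withLabels τ (cyclicWindow d i)

      withLabels-∘ₚ : withLabels π S ≡ withLabels (π ∘ₚ τ) (cyclicWindow d i)
      withLabels-∘ₚ = tabulate-cong λ v → lookup∘tabulate (lookup (cyclicWindow d i) ∘ (τ ⟨$⟩ʳ_)) (π ⟨$⟩ʳ v)

      ∣S∣≤1+d : ∣ S ∣ ≤ suc d
      ∣S∣≤1+d = ≤-trans (≤-reflexive (∣withLabels∣ τ (cyclicWindow d i))) (∣window∣≤ (toℕ i) (suc d))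

      S-label : ∀ {a} → a ∈ S → ∃[ j ] j ≤ d × toℕ a ≡ zigzag m ((toℕ i + j) % 1+m)
      S-label {a} a∈S =
        let j , j<1+d , eq = ∈-window⁻ (toℕ i) (suc d) (∈-withLabels⁻ τ a∈S)
        in j , ≤-pred j<1+d ,
           trans (sym (zigzag-position m (toℕ a) (≤-pred (toℕ<n a))))
                 (cong (zigzag m) (trans (sym (toℕ-zigzagPositions m a)) eq))

      diameter : ∀ {a b} → a ∈ S → b ∈ S → toℕ b ≤ d + d + toℕ a
      diameter a∈S b∈S =
        let j , j≤d , a≡ = S-label a∈S
            k , k≤d , b≡ = S-label b∈S
        in subst₂ (λ x y → y ≤ d + d + x) (sym a≡) (sym b≡) (proj₂ (cyclic-window m d (toℕ i) j≤d k≤d))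

      nonempty : Nonempty S
      nonempty = τ ⟨$⟩ˡ i , ∈-withLabels⁺ τ (subst (_∈ cyclicWindow d i) (sym (inverseʳ τ))
        (∈-window⁺ (toℕ i) (suc d) ≤-refl (m<m+n (toℕ i) (s≤s z≤n))))

      face : IsLabeledFace Δ π S
      face with minimum S nonempty
      ... | lo , lo∈S , lo≤ with toℕ lo + (d + d) <? 1+m
      ... | yes lo+2d<n = interval-face unitInterval (toℕ lo) lo+2d<n S ∣S∣≤1+d
        λ a a∈S → lo≤ a a∈S , subst (toℕ a ≤_) (+-comm (d + d) (toℕ lo)) (diameter lo∈S a∈S)
      -- The interval starting at `lo` would run past the last label `m`. The one ending at `m`
      -- starts no later than `lo`, so it contains `S`.
      ... | no lo+2d≮n = interval-face unitInterval (m ∸ (d + d)) (s≤s (≤-reflexive m∸2d+2d≡m)) S ∣S∣≤1+d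
        λ a a∈S → ≤-trans m∸2d≤lo (lo≤ a a∈S) ,
                  subst (toℕ a ≤_) (sym m∸2d+2d≡m) (≤-pred (toℕ<n a))
        where
        m∸2d+2d≡m : m ∸ (d + d) + (d + d) ≡ m
        m∸2d+2d≡m = m∸n+n≡m (≤-pred 2d<n)
        m∸2d≤lo : m ∸ (d + d) ≤ toℕ lo
        m∸2d≤lo = m≤n+o⇒m∸n≤o m (d + d) (subst (m ≤_) (+-comm (toℕ lo) (d + d)) (<⇒≤ (≮⇒≥ lo+2d≮n)))

theorem4 : ∀ (n d : ℕ) → 1 ≤ d → (Δ : SimplicialComplex n) →
    UnitInterval d Δ →
    (∀ (W : Subset n) → ∣ W ∣ ≤ d → StronglyConnected d (deletion Δ W)) →
    Hamiltonian d Δ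
theorem4 zero    d 1≤d Δ (_ , ((([] , _ , ()) , _) , _) , _) sc
theorem4 (suc m) d 1≤d Δ (vertices , (dim@((F , _ , ∣F∣≡1+d) , _) , _) , π , unitInterval) sc =
  vertices , dim , π ∘ₚ zigzagPositions m ,
  zigzag-hamiltonian 1≤d Δ sc vertices π unitInterval (2d<n 1≤d Δ sc d≤n)
  where
  d≤n : d ≤ suc m
  d≤n = <⇒≤ (subst (_≤ suc m) ∣F∣≡1+d (∣p∣≤n F))
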